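{- Let $n > 1$ be an integer, let $j = 2n-1$, and let $N = n^2 + j = n^2+2n-1$. Then the length of the period of the continued fraction of $\sqrt{N}$ is $4$ and $\sqrt{N} = [n, \overline{1, n-1, 1, 2n}]$.
   Context: The (simple) continued fraction expansion of an irrational real number $x$ is the unique infinite sequence $[a_0,a_1,a_2,\dots]$ with $a_0\in\mathbb Z$ and $a_i$ a positive integer for $i\ge 1$, such that the convergents $a_0+\cfrac{1}{a_1+\cfrac{1}{\ddots+\cfrac{1}{a_m}}}$ converge to $x$ as $m\to\infty$. The notation $[a_0,\dots,a_k,\overline{a_{k+1},\dots,a_\ell}]$ means that the block $a_{k+1},\dots,a_\ell$ is repeated infinitely many times after the preperiod $a_0,\dots,a_k$. The length of the period is the number of entries in the shortest repeating block. -}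

module Defs where

open import Data.Empty using (⊥-elim)
open import Data.Integer.Base using (ℤ; +_; -[1+_]; 1ℤ) renaming (_≤_ to _≤ᶻ_)
open import Data.List.Base as List using (List; []; _∷_; lookup)
open import Data.List.NonEmpty.Base as List⁺ using (List⁺; _∷_)
open import Data.Nat.Base as ℕ using (ℕ; zero; suc)
open import Data.Nat.DivMod using (_mod_)
open import Data.Product.Base using (∃; ∃-syntax; _×_; _,_; proj₁; proj₂)
open import Data.Rational.Base
open import Data.Rational.Properties
open import Data.Rational.Solver using (module +-*-Solver)
open import Data.Sum.Base using (_⊎_; inj₁; inj₂)
open import Function.Bundles using (_⇔_; mk⇔)
open import Relation.Binary.PropositionalEquality
open import Relation.Nullary using (¬_; yes; no)

-- Dedekind reals: `L q` means q < x and `U q` means x < q.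
record ℝ : Set₁ where
  field
    L U        : ℚ → Set
    inhabitedL : ∃ L
    inhabitedU : ∃ U
    roundedL   : ∀ q → L q ⇔ (∃[ r ] q < r × L r)
    roundedU   : ∀ q → U q ⇔ (∃[ r ] r < q × U r)
    disjoint   : ∀ q → ¬ (L q × U q)
    located    : ∀ {p q} → p < q → L p ⊎ U q

open ℝ public

infix 4 _≈_ _ConvergesTo_

_≈_ : ℝ → ℝ → Set
x ≈ y = (∀ q → L x q ⇔ L y q) × (∀ q → U x q ⇔ U y q)

private
  p<p+1 : ∀ p → p < p + 1ℚ
  p<p+1 p = subst (_< p + 1ℚ) (+-identityʳ p) (+-monoʳ-< p (positive⁻¹ 1ℚ))

  p-1<p : ∀ p → p - 1ℚ < p
  p-1<p p = subst (p - 1ℚ <_) (+-identityʳ p) (+-monoʳ-< p (negative⁻¹ (- 1ℚ)))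

fromℚ : ℚ → ℝ
fromℚ x = record
  { L          = _< x
  ; U          = x <_
  ; inhabitedL = x - 1ℚ , p-1<p x
  ; inhabitedU = x + 1ℚ , p<p+1 x
  ; roundedL   = λ q → mk⇔ <-dense (λ (r , q<r , r<x) → <-trans q<r r<x)
  ; roundedU   = λ q → mk⇔ (λ x<q → let (r , x<r , r<q) = <-dense x<q in r , r<q , x<r)
                           (λ (r , r<q , x<r) → <-trans x<r r<q)
  ; disjoint   = λ q (q<x , x<q) → <-asym q<x x<q
  ; located    = loc
  }
  where
  loc : ∀ {p q} → p < q → p < x ⊎ x < q
  loc {p} {q} p<q with p <? x
  ... | yes p<x = inj₁ p<x
  ... | no  p≮x = inj₂ (≤-<-trans (≮⇒≥ p≮x) p<q)

Irrational : ℝ → Set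
Irrational x = ∀ q → ¬ (x ≈ fromℚ q)

-- The two conjuncts together say |s m - x| < ε.
_ConvergesTo_ : (ℕ → ℚ) → ℝ → Set
s ConvergesTo x = ∀ ε → 0ℚ < ε → ∃[ M ] ∀ m → M ℕ.≤ m → L x (s m - ε) × U x (s m + ε)

module SquareRoot (N : ℕ) where

  private
    ν : ℚ
    ν = + N / 1

    0≤ν : 0ℚ ≤ ν
    0≤ν = nonNegative⁻¹ ν {{normalize-nonNeg N 1}}

    0<+0≤ : ∀ {p q} → 0ℚ < p → 0ℚ ≤ q → 0ℚ < p + q
    0<+0≤ = +-mono-<-≤

    0≤* : ∀ {p q} → 0ℚ ≤ p → 0ℚ ≤ q → 0ℚ ≤ p * q
    0≤* {p} {q} a b =
      nonNegative⁻¹ _ {{nonNeg*nonNeg⇒nonNeg p {{nonNegative a}} q {{nonNegative b}}}}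

    0<* : ∀ {p q} → 0ℚ < p → 0ℚ < q → 0ℚ < p * q
    0<* {p} {q} a b = positive⁻¹ _ {{pos*pos⇒pos p {{positive a}} q {{positive b}}}}

    0<⇒< : ∀ {p q} → 0ℚ < q - p → p < q
    0<⇒< {p} {q} h = subst₂ _<_ (+-identityʳ p)
      (solve 2 (λ p q → p :+ (q :- p) := q) refl p q) (+-monoʳ-< p h)
      where open +-*-Solver

    <⇒0< : ∀ {p q} → p < q → 0ℚ < q - p
    <⇒0< {p} {q} h = subst (_< q - p) (+-inverseʳ p) (+-monoˡ-< (- p) h)

    ≤⇒0≤ : ∀ {p q} → p ≤ q → 0ℚ ≤ q - p
    ≤⇒0≤ {p} {q} h = subst (_≤ q - p) (+-inverseʳ p) (+-monoˡ-≤ (- p) h)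

    divide : ∀ a b → 0ℚ < a → 0ℚ < b → ∃[ e ] 0ℚ < e × e * b ≡ a
    divide a b 0<a 0<b = a * inv , 0<* 0<a 0<inv ,
      trans (*-assoc a inv b) (trans (cong (a *_) (*-inverseˡ b {{nz}})) (*-identityʳ a))
      where
      nz = pos⇒nonZero b {{positive 0<b}}
      inv = (1/ b) {{nz}}
      0<inv : 0ℚ < inv
      0<inv = positive⁻¹ inv {{1/pos⇒pos b {{positive 0<b}}}}

    sq-mono : ∀ {p q} → 0ℚ ≤ p → p < q → p * p < q * q
    sq-mono {p} {q} 0≤p p<q = 0<⇒< (subst (0ℚ <_)
      (solve 2 (λ p q → (q :- p) :* ((q :- p) :+ (p :+ p)) := q :* q :- p :* p) refl p q)
      (0<* d (0<+0≤ d (+-mono-≤ 0≤p 0≤p))))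
      where
      open +-*-Solver
      d = <⇒0< p<q

  Lower Upper : ℚ → Set
  Lower q = q < 0ℚ ⊎ q * q < ν
  Upper q = 0ℚ < q × ν < q * q

  private
    lower-down : ∀ {q r} → q < r → Lower r → Lower q
    lower-down q<r (inj₁ r<0) = inj₁ (<-trans q<r r<0)
    lower-down {q} q<r (inj₂ h) with q <? 0ℚ
    ... | yes q<0 = inj₁ q<0
    ... | no  q≮0 = inj₂ (<-trans (sq-mono (≮⇒≥ q≮0) q<r) h)

    lower-open : ∀ {q} → Lower q → ∃[ r ] q < r × Lower r
    lower-open {q} l with q <? 0ℚ
    ... | yes q<0 = let (r , q<r , r<0) = <-dense q<0 in r , q<r , inj₁ r<0
    lower-open (inj₁ q<0)     | no q≮0 = ⊥-elim (q≮0 q<0)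
    lower-open {q} (inj₂ q²<ν) | no q≮0 = q + e , q<q+e , inj₂ (0<⇒< (subst (0ℚ <_) eq 0<slack))
      where
      open +-*-Solver
      0≤q = ≮⇒≥ q≮0
      d = ν - q * q
      0<d : 0ℚ < d
      0<d = <⇒0< q²<ν
      -- with e = d / (d + 2q + 1), ν - (q + e)² = e (d + 1 - e)
      b = d + ((q + q) + 1ℚ)
      0<b : 0ℚ < b
      0<b = 0<+0≤ 0<d (+-mono-≤ (+-mono-≤ 0≤q 0≤q) (<⇒≤ (positive⁻¹ 1ℚ)))
      quot = divide d b 0<d 0<b
      e = proj₁ quot
      0<e = proj₁ (proj₂ quot)
      eb≡d = proj₂ (proj₂ quot)
      q<q+e : q < q + e
      q<q+e = subst (_< q + e) (+-identityʳ q) (+-monoʳ-< q 0<e)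
      e<1 : e < 1ℚ
      e<1 = *-cancelʳ-<-nonNeg b {{nonNegative (<⇒≤ 0<b)}} (subst₂ _<_ (sym eb≡d) (sym (*-identityˡ b))
        (0<⇒< (subst (0ℚ <_)
          (solve 2 (λ d q → con 1ℚ :+ (q :+ q) := (d :+ ((q :+ q) :+ con 1ℚ)) :- d) refl d q)
          (0<+0≤ (positive⁻¹ 1ℚ) (+-mono-≤ 0≤q 0≤q)))))
      0<slack : 0ℚ < e * (d + (1ℚ - e))
      0<slack = 0<* 0<e (0<+0≤ 0<d (<⇒≤ (<⇒0< e<1)))
      eq : e * (d + (1ℚ - e)) ≡ ν - (q + e) * (q + e)
      eq = trans
        (solve 3 (λ d e q → e :* (d :+ (con 1ℚ :- e))
           := e :* (d :+ ((q :+ q) :+ con 1ℚ)) :- (e :* (q :+ q) :+ e :* e)) refl d e q)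
        (trans (cong (_- (e * (q + q) + e * e)) eb≡d)
        (solve 3 (λ v e q → (v :- q :* q) :- (e :* (q :+ q) :+ e :* e)
           := v :- (q :+ e) :* (q :+ e)) refl ν e q))

    upper-up : ∀ {q r} → r < q → Upper r → Upper q
    upper-up r<q (0<r , h) = <-trans 0<r r<q , <-trans h (sq-mono (<⇒≤ 0<r) r<q)

    upper-open : ∀ {q} → Upper q → ∃[ r ] r < q × Upper r
    upper-open {q} (0<q , ν<q²) = q - e , q-e<q , 0<q-e , 0<⇒< (subst (0ℚ <_) eq (0<* 0<e 0<e))
      where
      open +-*-Solver
      d = q * q - ν
      0<d : 0ℚ < d
      0<d = <⇒0< ν<q²
      -- with e = d / 2q, (q - e)² - ν = e²
      0<2q : 0ℚ < q + q
      0<2q = +-mono-< 0<q 0<q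
      quot = divide d (q + q) 0<d 0<2q
      e = proj₁ quot
      0<e = proj₁ (proj₂ quot)
      eb≡d = proj₂ (proj₂ quot)
      q-e<q : q - e < q
      q-e<q = 0<⇒< (subst (0ℚ <_) (solve 2 (λ e q → e := q :- (q :- e)) refl e q) 0<e)
      0<q-e : 0ℚ < q - e
      0<q-e = *-cancelʳ-<-nonNeg (q + q) {{nonNegative (<⇒≤ 0<2q)}} (subst₂ _<_ (sym (*-zeroˡ (q + q))) eq′
        (0<+0≤ (0<* 0<q 0<q) 0≤ν))
        where
        eq′ : q * q + ν ≡ (q - e) * (q + q)
        eq′ = trans (solve 2 (λ q v → q :* q :+ v := q :* (q :+ q) :- (q :* q :- v)) refl q ν)
          (trans (cong (λ z → q * (q + q) - z) (sym eb≡d))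
          (solve 2 (λ q e → q :* (q :+ q) :- e :* (q :+ q) := (q :- e) :* (q :+ q)) refl q e))
      eq : e * e ≡ (q - e) * (q - e) - ν
      eq = trans (solve 3 (λ q e v → e :* e
             := (q :- e) :* (q :- e) :+ (e :* (q :+ q) :- q :* q)) refl q e ν)
        (trans (cong (λ z → (q - e) * (q - e) + (z - q * q)) eb≡d)
        (solve 3 (λ q e v → (q :- e) :* (q :- e) :+ ((q :* q :- v) :- q :* q)
           := (q :- e) :* (q :- e) :- v) refl q e ν))

    disj : ∀ q → ¬ (Lower q × Upper q)
    disj q (inj₁ q<0  , 0<q , _) = <-asym q<0 0<q
    disj q (inj₂ q²<ν , _ , ν<q²) = <-asym q²<ν ν<q²

    loc : ∀ {p q} → p < q → Lower p ⊎ Upper q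
    loc {p} {q} p<q with p <? 0ℚ | p * p <? ν
    ... | yes p<0 | _        = inj₁ (inj₁ p<0)
    ... | no  _   | yes p²<ν = inj₁ (inj₂ p²<ν)
    ... | no  p≮0 | no  p²≮ν = inj₂ (≤-<-trans (≮⇒≥ p≮0) p<q ,
      ≤-<-trans (≮⇒≥ p²≮ν) (sq-mono (≮⇒≥ p≮0) p<q))

    upper-ν+1 : Upper (ν + 1ℚ)
    upper-ν+1 = ≤-<-trans 0≤ν (p<p+1 ν) , 0<⇒< (subst (0ℚ <_)
      (solve 1 (λ v → con 1ℚ :+ (v :* v :+ v) := (v :+ con 1ℚ) :* (v :+ con 1ℚ) :- v) refl ν)
      (0<+0≤ (positive⁻¹ 1ℚ) (+-mono-≤ (0≤* 0≤ν 0≤ν) 0≤ν)))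
      where open +-*-Solver

  root : ℝ
  root = record
    { L          = Lower
    ; U          = Upper
    ; inhabitedL = - 1ℚ , inj₁ (negative⁻¹ (- 1ℚ))
    ; inhabitedU = ν + 1ℚ , upper-ν+1
    ; roundedL   = λ q → mk⇔ lower-open (λ (r , q<r , l) → lower-down q<r l)
    ; roundedU   = λ q → mk⇔ upper-open (λ (r , r<q , u) → upper-up r<q u)
    ; disjoint   = disj
    ; located    = loc
    }

√_ : ℕ → ℝ
√_ = SquareRoot.root

-- Totalised by recip 0 = 0; when aᵢ ≥ 1 for all i ≥ 1, as required of continued
-- fractions below, `convergent` never takes the reciprocal of 0.
recip : ℚ → ℚ
recip (mkℚ (+ zero) _ _)       = 0ℚ
recip p@(mkℚ (+ suc _) _ _)    = 1/ p
recip p@(mkℚ -[1+ _ ] _ _) = 1/ p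

-- convergent a m = a₀ + 1/(a₁ + 1/(⋯ + 1/aₘ))
convergent : (ℕ → ℤ) → ℕ → ℚ
convergent a zero    = a 0 / 1
convergent a (suc m) = a 0 / 1 + recip (convergent (λ i → a (suc i)) m)

record IsContinuedFractionOf (x : ℝ) (a : ℕ → ℤ) : Set where
  field
    irrational : Irrational x
    partial≥1  : ∀ i → 1 ℕ.≤ i → 1ℤ ≤ᶻ a i
    converges  : convergent a ConvergesTo x

-- eventuallyPeriodic (a₀ ∷ ⋯ ∷ aₖ ∷ []) (aₖ₊₁ ∷ ⋯ ∷ aₗ) is [a₀,…,aₖ,\overline{aₖ₊₁,…,aₗ}].
eventuallyPeriodic : List ℤ → List⁺ ℤ → ℕ → ℤ
eventuallyPeriodic []       (b ∷ bs) i       = lookup (b ∷ bs) (i mod suc (List.length bs))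
eventuallyPeriodic (c ∷ cs) block    zero    = c
eventuallyPeriodic (c ∷ cs) block    (suc i) = eventuallyPeriodic cs block i

HasRepeatingBlock : (ℕ → ℤ) → List⁺ ℤ → Set
HasRepeatingBlock a block = ∃[ pre ] a ≗ eventuallyPeriodic pre block

record IsPeriodLength (a : ℕ → ℤ) (ℓ : ℕ) : Set where
  field
    attained : ∃[ block ] HasRepeatingBlock a block × List⁺.length block ≡ ℓ
    shortest : ∀ block → HasRepeatingBlock a block → ℓ ℕ.≤ List⁺.length block

-- A real number has at most one continued fraction expansion, hence at most one period length.
CFPeriodLength : ℝ → ℕ → Set
CFPeriodLength x ℓ = ∃[ a ] IsContinuedFractionOf x a × IsPeriodLength a ℓ

{-# OPTIONS --safe #-}

-- Write N = n² + 2n - 1 = (n + 1)² - 2. If c is a convergent of [n; 1, n-1, 1, 2n, …],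
-- then 2n = n + n makes the convergent one period later
--   c′ = n + 1/(1 + 1/((n - 1) + 1/(1 + 1/(n + c)))) = (A c + B N) / (B c + A)
-- with A = n² + 2n, B = n + 1 and A² - N B² = 1. Hence c′² - N = (c² - N) / (B c + A)²,
-- so c² - N tends to 0 and the convergents tend to √N. No block shorter than 4 repeats,
-- because 2n occurs only at multiples of 4.
module Submission where

open import Defs

module _ where
  open import Data.Empty using (⊥-elim)
  open import Data.Integer.Base as ℤ using (ℤ; +_; +[1+_]; -[1+_]; 1ℤ; +≤+)
  import Data.Integer.Properties as ℤ
  open import Data.Fin.Base using (Fin; zero; suc)
  open import Data.List.Base as List using ([]; _∷_; lookup)
  open import Data.List.NonEmpty.Base as List⁺ using (List⁺; _∷_)
  open import Data.Nat.Base as ℕ using (ℕ; zero; suc)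
  import Data.Nat.Properties as ℕ
  open import Data.Nat.Coprimality as Coprimality using (coprime-divisor)
  open import Data.Nat.Divisibility using (_∣_; divides; ∣-refl)
  open import Data.Nat.DivMod using (_mod_; [m+n]%n≡m%n)
  import Data.Fin.Properties as Fin
  open import Data.Nat.Tactic.RingSolver using (solve-∀)
  open import Data.Product.Base using (∃-syntax; _×_; _,_; proj₁; proj₂)
  open import Data.Rational.Base
  open import Data.Rational.Properties
  open import Data.Rational.Solver using (module +-*-Solver)
  import Data.Rational.Unnormalised.Base as ℚᵘ
  import Data.Rational.Unnormalised.Properties as ℚᵘ
  open import Data.Sum.Base using (inj₁; inj₂)
  open import Function.Base using (_∘_)
  open import Function.Bundles using (Equivalence)
  open import Relation.Binary.PropositionalEquality
  open import Relation.Nullary using (¬_; yes; no)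

  -- Order, absolute value and reciprocals in ℚ.

  0<q-p⇒p<q : ∀ {p q} → 0ℚ < q - p → p < q
  0<q-p⇒p<q {p} {q} 0<q-p = subst₂ _<_ (+-identityʳ p)
    (solve 2 (λ p q → p :+ (q :- p) := q) refl p q) (+-monoʳ-< p 0<q-p)
    where open +-*-Solver

  p<q⇒0<q-p : ∀ {p q} → p < q → 0ℚ < q - p
  p<q⇒0<q-p {p} {q} p<q = subst (_< q - p) (+-inverseʳ p) (+-monoˡ-< (- p) p<q)

  p≤q⇒0≤q-p : ∀ {p q} → p ≤ q → 0ℚ ≤ q - p
  p≤q⇒0≤q-p {p} {q} p≤q = subst (_≤ q - p) (+-inverseʳ p) (+-monoˡ-≤ (- p) p≤q)

  0<1 : 0ℚ < 1ℚ
  0<1 = positive⁻¹ 1ℚ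

  1≤p⇒0≤p : ∀ {p} → 1ℚ ≤ p → 0ℚ ≤ p
  1≤p⇒0≤p = ≤-trans (<⇒≤ 0<1)

  *-nonNeg : ∀ {p q} → 0ℚ ≤ p → 0ℚ ≤ q → 0ℚ ≤ p * q
  *-nonNeg {p} {q} 0≤p 0≤q =
    nonNegative⁻¹ _ {{nonNeg*nonNeg⇒nonNeg p {{nonNegative 0≤p}} q {{nonNegative 0≤q}}}}

  *-mono-≤-nonNeg : ∀ {p q r s} → 0ℚ ≤ p → 0ℚ ≤ s → p ≤ q → r ≤ s → p * r ≤ q * s
  *-mono-≤-nonNeg {p} {q} {r} {s} 0≤p 0≤s p≤q r≤s = ≤-trans
    (*-monoˡ-≤-nonNeg p {{nonNegative 0≤p}} r≤s) (*-monoʳ-≤-nonNeg s {{nonNegative 0≤s}} p≤q)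

  p≤∣p∣ : ∀ p → p ≤ ∣ p ∣
  p≤∣p∣ (mkℚ (+ _) _ _)      = ≤-refl
  p≤∣p∣ p@(mkℚ -[1+ _ ] _ _) = <⇒≤ (neg<pos p ∣ p ∣)

  -p≤∣p∣ : ∀ p → - p ≤ ∣ p ∣
  -p≤∣p∣ p = subst (- p ≤_) (∣-p∣≡∣p∣ p) (p≤∣p∣ (- p))

  -- Positivity excludes the default value of `recip` at 0; on a positive numerator `recip` is the
  -- true inverse.
  recip-inverseˡ : ∀ {p} → 0ℚ < p → recip p * p ≡ 1ℚ
  recip-inverseˡ {p@(mkℚ +[1+ _ ] _ _)} _   = *-inverseˡ p
  recip-inverseˡ {mkℚ (+ zero) _ _}     0<p with () ← positive 0<p
  recip-inverseˡ {mkℚ -[1+ _ ] _ _}     0<p with () ← positive 0<p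

  recip-pos : ∀ {p} → 0ℚ < p → 0ℚ < recip p
  recip-pos {p@(mkℚ +[1+ _ ] _ _)} _ = positive⁻¹ (1/ p) {{1/pos⇒pos p}}
  recip-pos {mkℚ (+ zero) _ _}     0<p with () ← positive 0<p
  recip-pos {mkℚ -[1+ _ ] _ _}     0<p with () ← positive 0<p

  -- Integers as rationals

  -- `i / 1` is normalised by a gcd and does not compute for a variable `i`. In the unnormalised
  -- rationals, facts about such fractions become integer statements about cross products.
  toℚᵘ-/1 : ∀ i → toℚᵘ (i / 1) ℚᵘ.≃ ℚᵘ.mkℚᵘ i 0
  toℚᵘ-/1 i = toℚᵘ-fromℚᵘ (ℚᵘ.mkℚᵘ i 0)

  /1-homo-+ : ∀ i j → (i ℤ.+ j) / 1 ≡ i / 1 + j / 1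
  /1-homo-+ i j = toℚᵘ-injective (begin
    toℚᵘ ((i ℤ.+ j) / 1)              ≈⟨ toℚᵘ-/1 (i ℤ.+ j) ⟩
    ℚᵘ.mkℚᵘ (i ℤ.+ j) 0               ≈⟨ ℚᵘ.*≡* (cong (ℤ._* + 1)
                                           (sym (cong₂ ℤ._+_ (ℤ.*-identityʳ i) (ℤ.*-identityʳ j)))) ⟩
    ℚᵘ.mkℚᵘ i 0 ℚᵘ.+ ℚᵘ.mkℚᵘ j 0      ≈⟨ ℚᵘ.+-cong (toℚᵘ-/1 i) (toℚᵘ-/1 j) ⟨
    toℚᵘ (i / 1) ℚᵘ.+ toℚᵘ (j / 1)    ≈⟨ toℚᵘ-homo-+ (i / 1) (j / 1) ⟨
    toℚᵘ (i / 1 + j / 1)              ∎)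
    where open import Relation.Binary.Reasoning.Setoid ℚᵘ.≃-setoid

  /1-homo-* : ∀ i j → (i ℤ.* j) / 1 ≡ (i / 1) * (j / 1)
  /1-homo-* i j = toℚᵘ-injective (begin
    toℚᵘ ((i ℤ.* j) / 1)              ≈⟨ toℚᵘ-/1 (i ℤ.* j) ⟩
    ℚᵘ.mkℚᵘ i 0 ℚᵘ.* ℚᵘ.mkℚᵘ j 0      ≈⟨ ℚᵘ.*-cong (toℚᵘ-/1 i) (toℚᵘ-/1 j) ⟨
    toℚᵘ (i / 1) ℚᵘ.* toℚᵘ (j / 1)    ≈⟨ toℚᵘ-homo-* (i / 1) (j / 1) ⟨
    toℚᵘ ((i / 1) * (j / 1))          ∎)
    where open import Relation.Binary.Reasoning.Setoid ℚᵘ.≃-setoid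

  /1-mono-≤ : ∀ {i j} → i ℤ.≤ j → i / 1 ≤ j / 1
  /1-mono-≤ {i} {j} i≤j = toℚᵘ-cancel-≤ (begin
    toℚᵘ (i / 1)    ≃⟨ toℚᵘ-/1 i ⟩
    ℚᵘ.mkℚᵘ i 0     ≤⟨ ℚᵘ.*≤* (ℤ.*-monoʳ-≤-nonNeg (+ 1) i≤j) ⟩
    ℚᵘ.mkℚᵘ j 0     ≃⟨ toℚᵘ-/1 j ⟨
    toℚᵘ (j / 1)    ∎)
    where open ℚᵘ.≤-Reasoning

  /1-suc : ∀ k → + suc k / 1 ≡ 1ℚ + + k / 1
  /1-suc k = /1-homo-+ (+ 1) (+ k)

  -- The denominator is at least 1. This supplies the explicit natural bound behind `archimedean`.
  ≤∣numerator∣ : ∀ p → p ≤ + ℤ.∣ ↥ p ∣ / 1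
  ≤∣numerator∣ p@(mkℚ i d-1 _) = toℚᵘ-cancel-≤
    (ℚᵘ.≤-respʳ-≃ (ℚᵘ.≃-sym (toℚᵘ-/1 (+ ℤ.∣ i ∣))) (ℚᵘ.*≤* (begin
      i ℤ.* + 1                     ≡⟨ ℤ.*-identityʳ i ⟩
      i                             ≤⟨ i≤∣i∣ i ⟩
      + ℤ.∣ i ∣                     ≤⟨ +≤+ (ℕ.m≤m*n ℤ.∣ i ∣ (suc d-1)) ⟩
      + (ℤ.∣ i ∣ ℕ.* suc d-1)       ≡⟨ ℤ.pos-* ℤ.∣ i ∣ (suc d-1) ⟩
      + ℤ.∣ i ∣ ℤ.* + suc d-1       ∎)))
    where
    open ℤ.≤-Reasoning
    i≤∣i∣ : ∀ i → i ℤ.≤ + ℤ.∣ i ∣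
    i≤∣i∣ (+ _)    = ℤ.≤-refl
    i≤∣i∣ -[1+ _ ] = ℤ.-≤+

  archimedean : ∀ p {ε} → 0ℚ < ε → ∃[ k ] p < ε * (+ suc k / 1)
  archimedean p {ε} 0<ε = k , subst₂ _<_ p/ε*ε≡p (*-comm (+ suc k / 1) ε)
    (*-monoˡ-<-pos ε {{positive 0<ε}} (≤-<-trans (≤∣numerator∣ p/ε) k<suck))
    where
    p/ε = p * recip ε
    k = ℤ.∣ ↥ p/ε ∣
    p/ε*ε≡p : p/ε * ε ≡ p
    p/ε*ε≡p = trans (*-assoc p (recip ε) ε)
      (trans (cong (p *_) (recip-inverseˡ 0<ε)) (*-identityʳ p))
    k<suck : + k / 1 < + suc k / 1
    k<suck = subst₂ _<_ (+-identityˡ _) (sym (/1-suc k)) (+-monoˡ-< (+ k / 1) 0<1)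

  -- Square roots of natural numbers

  -- Clearing denominators in q² = N gives i² = N d², so d divides i · i. As d is coprime to i, it
  -- divides i, and therefore d = 1.
  rationalSqrt⇒ℕ : ∀ {N} q → q * q ≡ + N / 1 → ∃[ p ] p ℕ.* p ≡ N
  rationalSqrt⇒ℕ {N} q@(mkℚ i d-1 coprime) q²≡N = ℤ.∣ i ∣ , trans i²≡Nd² (trans
    (cong (λ d → N ℕ.* (d ℕ.* d)) d≡1) (ℕ.*-identityʳ N))
    where
    d = suc d-1
    i⊥d = Coprimality.recompute coprime

    i²≡Nd² : ℤ.∣ i ∣ ℕ.* ℤ.∣ i ∣ ≡ N ℕ.* (d ℕ.* d)
    i²≡Nd² with ℚᵘ.*≡* eq ← ℚᵘ.≃-trans (ℚᵘ.≃-sym (toℚᵘ-homo-* q q))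
                              (ℚᵘ.≃-trans (toℚᵘ-cong q²≡N) (toℚᵘ-/1 (+ N))) = begin
      ℤ.∣ i ∣ ℕ.* ℤ.∣ i ∣                 ≡⟨ ℤ.abs-* i i ⟨
      ℤ.∣ i ℤ.* i ∣                       ≡⟨ cong ℤ.∣_∣ (ℤ.*-identityʳ (i ℤ.* i)) ⟨
      ℤ.∣ i ℤ.* i ℤ.* + 1 ∣               ≡⟨ cong ℤ.∣_∣ eq ⟩
      ℤ.∣ + N ℤ.* + (d ℕ.* d) ∣           ≡⟨ ℤ.abs-* (+ N) (+ (d ℕ.* d)) ⟩
      N ℕ.* (d ℕ.* d)                     ∎
      where open ≡-Reasoning

    d∣i : d ∣ ℤ.∣ i ∣
    d∣i = coprime-divisor (Coprimality.sym i⊥d)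
      (divides (N ℕ.* d) (trans i²≡Nd² (sym (ℕ.*-assoc N d d))))

    d≡1 : d ≡ 1
    d≡1 = i⊥d (d∣i , ∣-refl)

  ¬square : ∀ {n N} → n ℕ.* n ℕ.< N → N ℕ.< suc n ℕ.* suc n → ∀ p → p ℕ.* p ≢ N
  ¬square {n} n²<N N<[1+n]² p refl with ℕ.≤-<-connex p n
  ... | inj₁ p≤n = ℕ.<⇒≱ n²<N (ℕ.*-mono-≤ p≤n p≤n)
  ... | inj₂ n<p = ℕ.<⇒≱ N<[1+n]² (ℕ.*-mono-≤ n<p n<p)

  -- If √N were the cut of q, then q would lie in neither half, because q < q fails. That forces q²
  -- = N, so N would be a perfect square strictly between two consecutive squares.
  √-irrational : ∀ {n N} → n ℕ.* n ℕ.< N → N ℕ.< suc n ℕ.* suc n → Irrational (√ N)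
  √-irrational {n} {N} n²<N N<[1+n]² q (L⇔ , U⇔) =
    let p , p²≡N = rationalSqrt⇒ℕ q (≤-antisym q²≤N N≤q²) in ¬square {n} n²<N N<[1+n]² p p²≡N
    where
    ¬Lq : ¬ L (√ N) q
    ¬Lq = <-irrefl refl ∘ Equivalence.to (L⇔ q)
    ¬Uq : ¬ U (√ N) q
    ¬Uq = <-irrefl refl ∘ Equivalence.to (U⇔ q)

    N≤q² : + N / 1 ≤ q * q
    N≤q² = ≮⇒≥ (¬Lq ∘ inj₂)

    0<N : 0ℚ < + N / 1
    0<N = <-≤-trans 0<1 (/1-mono-≤ {1ℤ} {+ N} (+≤+ (ℕ.≤-trans (ℕ.s≤s ℕ.z≤n) n²<N)))

    0<q : 0ℚ < q
    0<q with 0ℚ <? q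
    ... | yes 0<q = 0<q
    -- A nonpositive q outside the lower half must be 0, yet 0 is in the lower half because 0 < N.
    ... | no  0≮q with refl ← ≤-antisym (≮⇒≥ 0≮q) (≮⇒≥ (¬Lq ∘ inj₁)) = ⊥-elim (¬Lq (inj₂ 0<N))

    q²≤N : q * q ≤ + N / 1
    q²≤N = ≮⇒≥ (λ N<q² → ¬Uq (0<q , N<q²))

  -- In the reals, |c - √N| = |c² - N| / (c + √N) < ε because c ≥ 1. The rational version writes N -
  -- (c - ε)² and (c + ε)² - N as a positive term plus nonnegative terms.
  √-within : ∀ {N c ε} → 1ℚ ≤ c → 0ℚ < ε → ∣ c * c - + N / 1 ∣ < ε →
             L (√ N) (c - ε) × U (√ N) (c + ε)
  √-within {N} {c} {ε} 1≤c 0<ε ∣e∣<ε = lower , +-mono-<-≤ (<-≤-trans 0<1 1≤c) (<⇒≤ 0<ε) , upper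
    where
    open +-*-Solver
    ν = + N / 1
    e = c * c - ν
    0≤c = 1≤p⇒0≤p 1≤c
    0≤ε = <⇒≤ 0<ε
    0≤ε[c-1] = *-nonNeg 0≤ε (p≤q⇒0≤q-p 1≤c)

    lower : L (√ N) (c - ε)
    lower with c - ε <? 0ℚ
    ... | yes c-ε<0 = inj₁ c-ε<0
    ... | no  c-ε≮0 = inj₂ (0<q-p⇒p<q (subst (0ℚ <_)
      (solve 3 (λ c ε v → (ε :- (c :* c :- v)) :+ (ε :* (c :- con 1ℚ) :+ ε :* (c :- ε))
                  := v :- (c :- ε) :* (c :- ε)) refl c ε ν)
      (+-mono-<-≤ (p<q⇒0<q-p (≤-<-trans (p≤∣p∣ e) ∣e∣<ε))
        (+-mono-≤ 0≤ε[c-1] (*-nonNeg 0≤ε (≮⇒≥ c-ε≮0))))))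

    upper : ν < (c + ε) * (c + ε)
    upper = 0<q-p⇒p<q (subst (0ℚ <_)
      (solve 3 (λ c ε v → (ε :- (:- (c :* c :- v))) :+ (ε :* (c :- con 1ℚ) :+ ε :* (c :+ ε))
                  := (c :+ ε) :* (c :+ ε) :- v) refl c ε ν)
      (+-mono-<-≤ (p<q⇒0<q-p (≤-<-trans (-p≤∣p∣ e) ∣e∣<ε))
        (+-mono-≤ 0≤ε[c-1] (*-nonNeg 0≤ε (+-mono-≤ 0≤c 0≤ε)))))

  -- Nonnegative sequences that at least halve every four steps.

  module _ (f : ℕ → ℚ) (0≤f : ∀ m → 0ℚ ≤ f m)
           (halve : ∀ m → f (4 ℕ.+ m) * (1ℚ + 1ℚ) ≤ f m) where

    -- Along each residue class modulo 4 the sequence does not increase, so the maximum of the first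
    -- four values is a bound.
    bounded : ∃[ K ] ∀ m → f m ≤ K
    bounded = K , f≤K
      where
      K = (f 0 ⊔ f 1) ⊔ (f 2 ⊔ f 3)
      decrease : ∀ m → f (4 ℕ.+ m) ≤ f m
      decrease m = ≤-trans (subst (_≤ f (4 ℕ.+ m) * (1ℚ + 1ℚ)) (*-identityʳ _)
        (*-monoˡ-≤-nonNeg (f (4 ℕ.+ m)) {{nonNegative (0≤f (4 ℕ.+ m))}} (+-monoʳ-≤ 1ℚ (<⇒≤ 0<1)))) (halve m)
      f≤K : ∀ m → f m ≤ K
      f≤K 0 = ≤-trans (p≤p⊔q (f 0) (f 1)) (p≤p⊔q _ _)
      f≤K 1 = ≤-trans (p≤q⊔p (f 0) (f 1)) (p≤p⊔q _ _)
      f≤K 2 = ≤-trans (p≤p⊔q (f 2) (f 3)) (p≤q⊔p (f 0 ⊔ f 1) _)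
      f≤K 3 = ≤-trans (p≤q⊔p (f 2) (f 3)) (p≤q⊔p (f 0 ⊔ f 1) _)
      f≤K (suc (suc (suc (suc m)))) = ≤-trans (decrease m) (f≤K m)

    -- Linear decay suffices: halving beats the factor (k + 2) / (k + 1) ≤ 2.
    decay : ∀ k {m} → k ℕ.* 4 ℕ.≤ m → f m * (+ suc k / 1) ≤ proj₁ bounded
    decay zero    {m} _ = subst (_≤ proj₁ bounded) (sym (*-identityʳ (f m))) (proj₂ bounded m)
    -- `suc k * 4` computes to `4 + k * 4`, so four matches on the inequality expose the index as
    -- `4 + m`.
    decay (suc k) (ℕ.s≤s (ℕ.s≤s (ℕ.s≤s (ℕ.s≤s {n = m} 4k≤m)))) = begin
      f (4 ℕ.+ m) * (+ suc (suc k) / 1)   ≡⟨ cong (f (4 ℕ.+ m) *_) (/1-suc (suc k)) ⟩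
      f (4 ℕ.+ m) * (1ℚ + t)              ≤⟨ *-monoˡ-≤-nonNeg (f (4 ℕ.+ m)) {{nonNegative (0≤f (4 ℕ.+ m))}}
                                               (+-monoˡ-≤ t 1≤t) ⟩
      f (4 ℕ.+ m) * (t + t)               ≡⟨ solve 2 (λ x t → x :* (t :+ t) := x :* (con 1ℚ :+ con 1ℚ) :* t)
                                               refl (f (4 ℕ.+ m)) t ⟩
      f (4 ℕ.+ m) * (1ℚ + 1ℚ) * t         ≤⟨ *-monoʳ-≤-nonNeg t {{nonNegative (1≤p⇒0≤p 1≤t)}} (halve m) ⟩
      f m * t                             ≤⟨ decay k 4k≤m ⟩
      proj₁ bounded                       ∎
      where
      open ≤-Reasoning
      open +-*-Solver
      t = + suc k / 1
      1≤t : 1ℚ ≤ t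
      1≤t = /1-mono-≤ {1ℤ} {+ suc k} (+≤+ (ℕ.s≤s ℕ.z≤n))

    vanishes : ∀ ε → 0ℚ < ε → ∃[ M ] ∀ m → M ℕ.≤ m → f m < ε
    vanishes ε 0<ε with k , K<εt ← archimedean (proj₁ bounded) 0<ε = k ℕ.* 4 , λ m 4k≤m →
      *-cancelʳ-<-nonNeg (+ suc k / 1)
        {{nonNegative (/1-mono-≤ {+ 0} {+ suc k} (+≤+ ℕ.z≤n))}}
        (≤-<-trans (decay k 4k≤m) K<εt)

  -- The expansion of √(n² + 2n - 1)

  1≤convergent : ∀ a → (∀ i → 1ℤ ℤ.≤ a i) → ∀ m → 1ℚ ≤ convergent a m
  1≤convergent a 1≤a zero    = /1-mono-≤ (1≤a 0)
  1≤convergent a 1≤a (suc m) = subst (_≤ convergent a (suc m)) (+-identityʳ 1ℚ)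
    (+-mono-≤ (/1-mono-≤ (1≤a 0)) (<⇒≤ (recip-pos (<-≤-trans 0<1 (1≤convergent (a ∘ suc) (1≤a ∘ suc) m)))))

  -- If z = P / Q, then a + 1/z = (a P + Q) / P: the continuant recurrence, stated without division
  -- so that it can be iterated.
  continuant-step : ∀ a {z P Q} → 0ℚ < z → z * Q ≡ P → (a + recip z) * P ≡ a * P + Q
  continuant-step a {z} {P} {Q} 0<z zQ≡P = begin
    (a + recip z) * P             ≡⟨ *-distribʳ-+ P a (recip z) ⟩
    a * P + recip z * P           ≡⟨ cong (λ P → a * _ + recip z * P) zQ≡P ⟨
    a * P + recip z * (z * Q)     ≡⟨ cong (_+_ (a * P)) (*-assoc (recip z) z Q) ⟨
    a * P + recip z * z * Q       ≡⟨ cong (λ x → a * P + x * Q) (recip-inverseˡ 0<z) ⟩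
    a * P + 1ℚ * Q                ≡⟨ cong (_+_ (a * P)) (*-identityˡ Q) ⟩
    a * P + Q                     ∎
    where open ≡-Reasoning

  -- Here θ is n - 1, η is n and ν is N. Multiplying c′² - ν by D² gives c² - ν, and D ≥ 2 makes D²
  -- ≥ 2. Writing η as 1 + θ leaves an identity between polynomials in θ and c.
  period-halves : ∀ {θ ν c} → 0ℚ ≤ θ → 1ℚ ≤ c →
    let η = 1ℚ + θ
        c′ = η + recip (1ℚ + recip (θ + recip (1ℚ + recip (η + c)))) in
    ν + 1ℚ ≡ η * η + (η + η) →
    ∣ c′ * c′ - ν ∣ * (1ℚ + 1ℚ) ≤ ∣ c * c - ν ∣
  period-halves {θ} {ν} {c} 0≤θ 1≤c ν+1≡ = begin
    ∣ c′ * c′ - ν ∣ * (1ℚ + 1ℚ)      ≤⟨ *-monoˡ-≤-nonNeg ∣ c′ * c′ - ν ∣ {{∣-∣-nonNeg (c′ * c′ - ν)}} 2≤D² ⟩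
    ∣ c′ * c′ - ν ∣ * (D * D)        ≡⟨ cong (∣ c′ * c′ - ν ∣ *_) (0≤p⇒∣p∣≡p (*-nonNeg 0≤D 0≤D)) ⟨
    ∣ c′ * c′ - ν ∣ * ∣ D * D ∣      ≡⟨ ∣p*q∣≡∣p∣*∣q∣ (c′ * c′ - ν) (D * D) ⟨
    ∣ (c′ * c′ - ν) * (D * D) ∣      ≡⟨ cong ∣_∣ norm ⟩
    ∣ c * c - ν ∣                    ∎
    where
    open +-*-Solver
    η = 1ℚ + θ
    y = η + c
    z₃ = 1ℚ + recip y
    z₂ = θ + recip z₃
    z₁ = 1ℚ + recip z₂
    c′ = η + recip z₁
    -- Continuants from the inside out: z₃ = R / y, z₂ = Q / R, z₁ = D / Q. The factors `1ℚ` keep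
    -- the form produced by `continuant-step`.
    R = 1ℚ * y + 1ℚ
    Q = θ * R + y
    D = 1ℚ * Q + R

    0<y : 0ℚ < y
    0<y = +-mono-<-≤ (+-mono-<-≤ 0<1 0≤θ) (1≤p⇒0≤p 1≤c)
    0<z₃ : 0ℚ < z₃
    0<z₃ = +-mono-< 0<1 (recip-pos 0<y)
    0<z₂ : 0ℚ < z₂
    0<z₂ = +-mono-≤-< 0≤θ (recip-pos 0<z₃)
    0<z₁ : 0ℚ < z₁
    0<z₁ = +-mono-< 0<1 (recip-pos 0<z₂)

    c′D≡ : c′ * D ≡ η * D + Q
    c′D≡ = continuant-step η 0<z₁ (continuant-step 1ℚ 0<z₂
      (continuant-step θ 0<z₃ (continuant-step 1ℚ 0<y (*-identityʳ y))))

    1≤R : 1ℚ ≤ R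
    1≤R = subst (_≤ R) (+-identityˡ 1ℚ)
      (+-monoˡ-≤ 1ℚ (subst (0ℚ ≤_) (sym (*-identityˡ y)) (<⇒≤ 0<y)))
    1≤Q : 1ℚ ≤ Q
    1≤Q = subst (_≤ Q) (+-identityˡ 1ℚ) (+-mono-≤ (*-nonNeg 0≤θ (1≤p⇒0≤p 1≤R))
      (subst (_≤ y) (+-identityʳ 1ℚ) (+-mono-≤ (subst (_≤ η) (+-identityʳ 1ℚ) (+-monoʳ-≤ 1ℚ 0≤θ))
        (1≤p⇒0≤p 1≤c))))
    2≤D : 1ℚ + 1ℚ ≤ D
    2≤D = +-mono-≤ (subst (1ℚ ≤_) (sym (*-identityˡ Q)) 1≤Q) 1≤R
    1≤2 : 1ℚ ≤ 1ℚ + 1ℚ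
    1≤2 = +-monoʳ-≤ 1ℚ (<⇒≤ 0<1)
    0≤D : 0ℚ ≤ D
    0≤D = 1≤p⇒0≤p (≤-trans 1≤2 2≤D)
    2≤D² : 1ℚ + 1ℚ ≤ D * D
    2≤D² = *-mono-≤-nonNeg (1≤p⇒0≤p 1≤2) 0≤D 2≤D (≤-trans 1≤2 2≤D)

    ν≡ : ν ≡ η * η + (η + η) - 1ℚ
    ν≡ = trans (solve 1 (λ v → v := v :+ con 1ℚ :- con 1ℚ) refl ν) (cong (_- 1ℚ) ν+1≡)

    -- D is the denominator B c + A of c′, so this is where A² - N B² = 1 enters.
    norm : (c′ * c′ - ν) * (D * D) ≡ c * c - ν
    norm = begin-equality
      (c′ * c′ - ν) * (D * D)                     ≡⟨ solve 3 (λ x v d → (x :* x :- v) :* (d :* d)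
                                                       := (x :* d) :* (x :* d) :- v :* (d :* d)) refl c′ ν D ⟩
      (c′ * D) * (c′ * D) - ν * (D * D)           ≡⟨ cong₂ (λ x v → x * x - v * (D * D)) c′D≡ ν≡ ⟩
      (η * D + Q) * (η * D + Q) - (η * η + (η + η) - 1ℚ) * (D * D)
        ≡⟨ solve 2 (λ t c →
             let h = con 1ℚ :+ t
                 y = h :+ c
                 R = con 1ℚ :* y :+ con 1ℚ
                 Q = t :* R :+ y
                 D = con 1ℚ :* Q :+ R
                 v = h :* h :+ (h :+ h) :- con 1ℚ
             in (h :* D :+ Q) :* (h :* D :+ Q) :- v :* (D :* D) := c :* c :- v) refl θ c ⟩
      c * c - (η * η + (η + η) - 1ℚ)              ≡⟨ cong (λ v → c * c - v) ν≡ ⟨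
      c * c - ν                                   ∎
      where open ≤-Reasoning
    open ≤-Reasoning

  -- Repeating blocks.

  block-repeats : ∀ {a} block → ((pre , _) : HasRepeatingBlock a block) →
            ∀ i → a (List.length pre ℕ.+ (i ℕ.+ List⁺.length block)) ≡ a (List.length pre ℕ.+ i)
  block-repeats {a} block@(b ∷ bs) (pre , a≗) i = begin
    a (p ℕ.+ (i ℕ.+ suc (List.length bs)))       ≡⟨ a≗ (p ℕ.+ (i ℕ.+ suc (List.length bs))) ⟩
    eventuallyPeriodic pre block (p ℕ.+ (i ℕ.+ suc (List.length bs)))  ≡⟨ skip pre (i ℕ.+ suc (List.length bs)) ⟩
    eventuallyPeriodic [] block (i ℕ.+ suc (List.length bs))
      -- Past the preperiod only the remainder of the index matters; equal remainders are lifted to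
      -- equal elements of `Fin`.
      ≡⟨ cong (lookup (b ∷ bs)) (Fin.fromℕ<-cong _ _ ([m+n]%n≡m%n i (suc (List.length bs))) _ _) ⟩
    eventuallyPeriodic [] block i                ≡⟨ skip pre i ⟨
    eventuallyPeriodic pre block (p ℕ.+ i)       ≡⟨ a≗ (p ℕ.+ i) ⟨
    a (p ℕ.+ i)                                  ∎
    where
    open ≡-Reasoning
    p = List.length pre
    skip : ∀ pre i → eventuallyPeriodic pre block (List.length pre ℕ.+ i) ≡ eventuallyPeriodic [] block i
    skip []        i = refl
    skip (_ ∷ pre) i = skip pre i

  -- The condition n > 1 is encoded as n = k + 2, so that n - 1 computes to the positive integer
  -- `+ suc k`.
  module Expansion (k : ℕ) where
    n : ℕ
    n = suc (suc k)

    block : List⁺ ℤ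
    block = 1ℤ ∷ (+ n ℤ.- 1ℤ) ∷ 1ℤ ∷ + (2 ℕ.* n) ∷ []

    a : ℕ → ℤ
    a = eventuallyPeriodic (+ n ∷ []) block

    1≤a : ∀ i → 1ℤ ℤ.≤ a i
    1≤a zero    = +≤+ (ℕ.s≤s ℕ.z≤n)
    1≤a (suc i) = 1≤block (i mod 4)
      where
      1≤block : (f : Fin 4) → 1ℤ ℤ.≤ lookup (List⁺.toList block) f
      1≤block zero                   = ℤ.≤-refl
      1≤block (suc zero)             = +≤+ (ℕ.s≤s ℕ.z≤n)
      1≤block (suc (suc zero))       = ℤ.≤-refl
      1≤block (suc (suc (suc zero))) = +≤+ (ℕ.s≤s ℕ.z≤n)

    θ η : ℚ
    θ = + suc k / 1
    η = 1ℚ + θ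

    η≡n : η ≡ + n / 1
    η≡n = sym (/1-suc (suc k))

    -- Since 2n = n + n, the complete quotient after one period is n plus the original sequence.
    convergent-shift : ∀ m → convergent (λ i → a (4 ℕ.+ i)) m ≡ η + convergent a m
    convergent-shift zero    = trans 2n≡ (cong (_+ (+ n / 1)) (sym η≡n))
      where
      2n≡ : + (2 ℕ.* n) / 1 ≡ + n / 1 + + n / 1
      2n≡ = trans (cong (λ x → + (n ℕ.+ x) / 1) (ℕ.+-identityʳ n)) (/1-homo-+ (+ n) (+ n))
    convergent-shift (suc m) = trans
      (cong (_+ recip (convergent (a ∘ suc) m)) (convergent-shift zero))
      (+-assoc η (+ n / 1) _)

    -- Four layers of `convergent` unfold by computation; only the leading n and the innermost tail
    -- need rewriting.
    convergent-period : ∀ m → convergent a (4 ℕ.+ m) ≡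
      η + recip (1ℚ + recip (θ + recip (1ℚ + recip (η + convergent a m))))
    convergent-period m = cong₂ (λ x y → x + recip (1ℚ + recip (θ + recip (1ℚ + recip y))))
      (sym η≡n) (convergent-shift m)

    module _ {N : ℕ} (N+1≡ : N ℕ.+ 1 ≡ n ℕ.* n ℕ.+ (n ℕ.+ n)) where

      ν+1≡ : + N / 1 + 1ℚ ≡ η * η + (η + η)
      ν+1≡ = begin
        + N / 1 + 1ℚ                                        ≡⟨ /1-homo-+ (+ N) 1ℤ ⟨
        + (N ℕ.+ 1) / 1                                     ≡⟨ cong (λ x → + x / 1) N+1≡ ⟩
        + (n ℕ.* n ℕ.+ (n ℕ.+ n)) / 1                       ≡⟨ /1-homo-+ (+ (n ℕ.* n)) (+ (n ℕ.+ n)) ⟩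
        + (n ℕ.* n) / 1 + + (n ℕ.+ n) / 1                   ≡⟨ cong₂ _+_ (/1-homo-* (+ n) (+ n)) (/1-homo-+ (+ n) (+ n)) ⟩
        (+ n / 1) * (+ n / 1) + (+ n / 1 + + n / 1)         ≡⟨ cong (λ x → x * x + (x + x)) η≡n ⟨
        η * η + (η + η)                                     ∎
        where open ≡-Reasoning

      converges : convergent a ConvergesTo √ N
      converges ε 0<ε =
        let M , small = vanishes error (λ m → 0≤∣p∣ _) halves ε 0<ε
        in M , λ m M≤m → √-within {N} (1≤convergent a 1≤a m) 0<ε (small m M≤m)
        where
        error : ℕ → ℚ
        error m = ∣ convergent a m * convergent a m - + N / 1 ∣
        halves : ∀ m → error (4 ℕ.+ m) * (1ℚ + 1ℚ) ≤ error m
        halves m = subst (λ x → ∣ x * x - + N / 1 ∣ * (1ℚ + 1ℚ) ≤ error m) (sym (convergent-period m))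
          (period-halves (/1-mono-≤ {+ 0} {+ suc k} (+≤+ ℕ.z≤n)) (1≤convergent a 1≤a m) ν+1≡)

      -- With `N<[1+n]²`, this places N strictly between consecutive squares, as irrationality
      -- requires.
      n²<N : n ℕ.* n ℕ.< N
      n²<N = ℕ.+-cancelʳ-≤ 1 _ _ (subst (suc (n ℕ.* n) ℕ.+ 1 ℕ.≤_) (sym N+1≡)
        (subst (ℕ._≤ n ℕ.* n ℕ.+ (n ℕ.+ n)) (eq (n ℕ.* n)) (ℕ.+-monoʳ-≤ (n ℕ.* n) (ℕ.s≤s (ℕ.s≤s ℕ.z≤n)))))
        where
        eq : ∀ x → x ℕ.+ 2 ≡ suc x ℕ.+ 1
        eq = solve-∀

      N<[1+n]² : N ℕ.< suc n ℕ.* suc n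
      N<[1+n]² = ℕ.≤-trans (ℕ.≤-reflexive (trans (ℕ.+-comm 1 N) N+1≡))
        (subst (n ℕ.* n ℕ.+ (n ℕ.+ n) ℕ.≤_) (eq n) (ℕ.n≤1+n _))
        where
        eq : ∀ n → suc (n ℕ.* n ℕ.+ (n ℕ.+ n)) ≡ suc n ℕ.* suc n
        eq = solve-∀

      isContinuedFraction : IsContinuedFractionOf (√ N) a
      isContinuedFraction = record
        { irrational = √-irrational {n} n²<N N<[1+n]²
        ; partial≥1  = λ i _ → 1≤a i
        ; converges  = converges
        }

    -- Minimality of the period.

    a-periodic : ∀ p j → a (suc (p ℕ.* 4 ℕ.+ j)) ≡ a (suc j)
    a-periodic zero    j = refl
    a-periodic (suc p) j = a-periodic p j

    -- A block need only repeat after its preperiod, of length p. The known period 4 moves index 4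
    -- forward by 4p, beyond the preperiod; there the shift by ℓ applies, and period 4 leads back.
    a-repeats-at-4 : ∀ block → HasRepeatingBlock a block → a (4 ℕ.+ List⁺.length block) ≡ a 4
    a-repeats-at-4 block rep@(pre , _) = begin
      a (4 ℕ.+ ℓ)                          ≡⟨ a-periodic p (3 ℕ.+ ℓ) ⟨
      a (suc (p ℕ.* 4 ℕ.+ (3 ℕ.+ ℓ)))      ≡⟨ cong a (eq p ℓ) ⟩
      -- The split 4p + 4 = p + (3p + 4) isolates the preperiod.
      a (p ℕ.+ (suc (p ℕ.* 3 ℕ.+ 3) ℕ.+ ℓ))  ≡⟨ block-repeats block rep (suc (p ℕ.* 3 ℕ.+ 3)) ⟩
      a (p ℕ.+ suc (p ℕ.* 3 ℕ.+ 3))        ≡⟨ cong a (eq′ p) ⟩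
      a (suc (p ℕ.* 4 ℕ.+ 3))              ≡⟨ a-periodic p 3 ⟩
      a 4                                  ∎
      where
      open ≡-Reasoning
      p = List.length pre
      ℓ = List⁺.length block
      eq : ∀ p ℓ → suc (p ℕ.* 4 ℕ.+ (3 ℕ.+ ℓ)) ≡ p ℕ.+ (suc (p ℕ.* 3 ℕ.+ 3) ℕ.+ ℓ)
      eq = solve-∀
      eq′ : ∀ p → p ℕ.+ suc (p ℕ.* 3 ℕ.+ 3) ≡ suc (p ℕ.* 4 ℕ.+ 3)
      eq′ = solve-∀

    isPeriodLength : IsPeriodLength a 4
    isPeriodLength = record
      { attained = block , (+ n ∷ [] , λ _ → refl) , refl
      ; shortest = λ b rep → 4≤length b (a-repeats-at-4 b rep)
      }
      where
      -- `a 4` is 2n, whereas lengths 1, 2 and 3 would equate it with `a 5` = 1, `a 6` = n - 1 and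
      -- `a 7` = 1.
      4≤length : ∀ b → a (4 ℕ.+ List⁺.length b) ≡ a 4 → 4 ℕ.≤ List⁺.length b
      4≤length (_ ∷ [])              ()
      4≤length (_ ∷ _ ∷ [])          n-1≡2n = ⊥-elim (ℕ.m≢1+m+n (suc k) (ℤ.+-injective n-1≡2n))
      4≤length (_ ∷ _ ∷ _ ∷ [])      ()
      4≤length (_ ∷ _ ∷ _ ∷ _ ∷ _)   _ = ℕ.s≤s (ℕ.s≤s (ℕ.s≤s (ℕ.s≤s ℕ.z≤n)))

open import Data.Nat using (ℕ; zero; suc; z≤n; s≤s; _+_; _*_; _∸_; _^_; _>_)
open import Data.Nat.Properties using (+-∸-assoc)
open import Data.Nat.Tactic.RingSolver using (solve-∀)
open import Data.Integer using (+_; 1ℤ) renaming (_-_ to _-ᶻ_)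
open import Data.List using (List; []; _∷_)
open import Data.List.NonEmpty using (List⁺; _∷_)
open import Data.Product using (_×_; _,_)
open import Relation.Binary.PropositionalEquality using (_≡_; refl; sym; trans; cong)

mainTheorem4 : (n j N : ℕ) → n > 1 → j ≡ 2 * n ∸ 1 → N ≡ n ^ 2 + j →
    N ≡ n ^ 2 + 2 * n ∸ 1
    × CFPeriodLength (√ N) 4
    × IsContinuedFractionOf (√ N) (eventuallyPeriodic (+ n ∷ []) (1ℤ ∷ (+ n -ᶻ 1ℤ) ∷ 1ℤ ∷ + (2 * n) ∷ []))
mainTheorem4 (suc (suc k)) _ N (s≤s (s≤s _)) refl N≡ =
  -- Truncated subtraction reassociates because 1 ≤ 2n.
  trans N≡ (sym (+-∸-assoc (n ^ 2) {2 * n} (s≤s z≤n))) , (a , expansion , isPeriodLength) , expansion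
  where
  open Expansion k
  -- The left side is the computed form of n² + (2n - 1) + 1 at n = k + 2, with the trailing `* 1`
  -- from `_^_` and `+ 0` from `2 * n`.
  eq : ∀ k → (2 + k) * ((2 + k) * 1) + (suc k + (2 + k + 0)) + 1 ≡ (2 + k) * (2 + k) + ((2 + k) + (2 + k))
  eq = solve-∀
  expansion : IsContinuedFractionOf (√ N) a
  expansion = isContinuedFraction (trans (cong (_+ 1) N≡) (eq k))
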